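{- Let $n\ge3$ and let $\lambda\vdash n$ be a two-row partition. Then the weight function $m$ of the $\mathcal S_n$-graph $\Gamma_\lambda=(\mathrm{SYT}(\lambda),m,\mathrm{des})$ is given as follows, for $s,t\in\mathrm{SYT}(\lambda)$. 1) (Move of the first kind) $m(s\triangleright t)=1$ if $t$ is obtained from $s$ by interchanging $i\in s^1$ and $i+1\in s^2$ for some $1\le i\le n-1$. 2) (Move of the second kind) $m(s\triangleright t)=1$ if $t$ is obtained from $s$ by interchanging $i\in s^2$ and $j\in s^1$, where the following conditions hold: (a) $1<i<j\le n$ and $j-i$ is odd; (b) $i+1\in s^1$ and $j-1\in s^2$; (c) either $i-1\in s^1$ or $j+1\in s^2$ (if $j=n$, then $j+1\notin s^2$ by convention); (d) $\#\{\alpha\in s^2\mid\alpha\in[j-1-2k,j-2]\}\ge k$ for all $k\in[1,\frac{j-i-3}{2}]$; (e) $\#\{\alpha\in s^2\mid\alpha\in[i+2,j-2]\}=\frac{j-i-3}{2}$ when $j\ne i+1$. 3) Otherwise, $m(s\triangleright t)=0$.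
   Context: **Conventions.** $[a,b]=\{x\in\mathbb Z\mid a\le x\le b\}$; for $k\in\mathbb Z$, $\overline k$ is the element of $\{1,\dots,n\}$ congruent to $k$ mod $n$. For $a,b\in\{1,\dots,n\}$, $\langle a,b\rangle$ is $\emptyset$ if $a=\overline{b+1}$, else the cyclic interval $\{a,\overline{a+1},\dots,b\}$. $\mathrm{RSYT}(\lambda)$ (resp. $\mathrm{SYT}(\lambda)$) is the set of row-standard (resp. standard) Young tableaux of shape $\lambda=(\lambda_1,\lambda_2)$, $\lambda_1\ge\lambda_2\ge1$ (English convention), with entries $1,\dots,n$ each used once; $T^1$ (top), $T^2$ are the rows of $T$ as sets; interchanging entries is followed by re-sorting rows. $\overline{\mathrm{des}}(T)=\{i\in[1,n]\mid i$ lies in a strictly higher row than $\overline{i+1}\}$ and $\mathrm{des}(T)=\overline{\mathrm{des}}(T)-\{n\}$. **Labeled graphs.** An $I$-labeled graph is a triple $(V,m,\tau)$, $m:V\times V\to\mathbb Z[q^{\pm1/2}]$ (written $m(u\triangleright v)$), $\tau:V\to\{\text{subsets of }I\}$. Its parabolic restriction to $J\subset I$, written $\Gamma\!\downarrow_J$, has the same vertices, $\tau'(v)=\tau(v)\cap J$, and $m'(u\triangleright v)=m(u\triangleright v)$ if $\tau'(u)\not\subset\tau'(v)$ and $0$ otherwise. A full subgraph is obtained by restricting $m,\tau$ to a subset of vertices. **The graph $\Gamma_\lambda$.** Up to isomorphism, $\Gamma_\lambda$ is the Kazhdan–Lusztig $W$-graph of $\mathcal S_n$ (in reduced form, i.e.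 with $m(u\triangleright v)$ set to $0$ whenever $\tau(u)\subset\tau(v)$) attached to a left cell whose elements have Robinson–Schensted shape $\lambda$; here $\tau(w)$ is the left descent set and, for $\tau(u)\not\subset\tau(v)$, $m(u\triangleright v)$ is the symmetric Kazhdan–Lusztig coefficient $\mu(u,v)=\mu(v,u)$. It is identified with the full subgraph of $\overline\Gamma_\lambda\!\downarrow_{[1,n-1]}$ with vertex set $\mathrm{SYT}(\lambda)$, to which it is isomorphic; under this identification $\tau=\mathrm{des}$. **The graph $\overline\Gamma_\lambda$.** The $[1,n]$-labeled graph $(\mathrm{RSYT}(\lambda),m,\overline{\mathrm{des}})$ with $m\in\{0,1\}$ and $m(s\triangleright t)=1$ iff: (first kind) $t$ is obtained from $s$ by interchanging $\overline i\in s^1$ and $\overline{i+1}\in s^2$; or (second kind) $t$ is obtained from $s$ by interchanging $\overline i\in s^2$ and $\overline j\in s^1$, $\overline i\ne\overline{j+1}$, where $\overline{j-i}$ is odd; $\overline{i+1}\in s^1$ and $\overline{j-1}\in s^2$; $\overline{i-1}\in s^1$ or $\overline{j+1}\in s^2$; $\#(s^2\cap\langle\overline{j-1-2k},\overline{j-2}\rangle)\ge k$ for $k\in\{1,\dots,\frac{\overline{j-i}-3}2\}$; and $\#(s^2\cap\langle\overline{i+2},\overline{j-2}\rangle)=\frac{\overline{j-i}-3}2$ when $\overline j\neq\overline{i+1}$. -}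

module Defs where

import Data.Nat.Properties as ℕ
open ℕ using (_≟_; _≤?_; _<?_; ≤-trans; m≤m+n; ≤∧≢⇒<)
open import Data.Bool.Base using (true; false; if_then_else_)
open import Data.Fin.Base as Fin using (Fin; toℕ; inject₁; inject≤)
open import Data.Fin.Permutation.Components using (transpose; transpose-inverse)
import Data.Fin.Properties as Fin
open import Data.Integer.Base as ℤ using (ℤ; +_; _%ℕ_)
import Data.Integer.Properties as ℤ
open import Data.Irrelevant using ([_])
open import Data.List.Base using (List; []; _∷_; _++_; map; filter; foldl; foldr; length; concatMap; applyUpTo; allFin; cartesianProduct; cartesianProductWith)
open import Data.List.Membership.DecPropositional ℕ._≟_ using (_∈_; _∈?_)
open import Data.List.Membership.Propositional.Properties using (∈-filter⁺; ∈-filter⁻; ∈-applyUpTo⁺; ∈-applyUpTo⁻; ∈-map⁻)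
import Data.List.Properties as List
open import Data.List.Relation.Binary.Permutation.Propositional using (_↭_)
open import Data.List.Relation.Binary.Subset.DecPropositional ℕ._≟_ using (_⊆_; _⊆?_)
open import Data.List.Relation.Unary.All using (All; all?)
open import Data.List.Relation.Unary.Any using (Any; any?)
import Data.List.Sort.InsertionSort ℕ.≤-decTotalOrder as InsertionSort
open import Data.Maybe.Base using (Maybe; just; nothing)
open import Data.Nat.Base
open import Data.Nat.DivMod using (_/_; _%_)
open import Data.Product.Base using (∃₂; ∃-syntax; _×_; _,_; proj₁; proj₂)
open import Data.Refinement as Refinement using (Refinement-syntax; value; _,_)
open import Data.Sum.Base using (_⊎_)
open import Data.Vec.Base as Vec using (Vec; lookup; toList)
import Data.Vec.Properties as Vec
open import Function.Definitions using (Injective)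
open import Relation.Binary.Construct.Closure.ReflexiveTransitive using (Star)
open import Relation.Binary.PropositionalEquality
open import Relation.Nullary using (¬_; Dec; does)
open import Relation.Nullary.Decidable using (_×-dec_; _⊎-dec_; _→-dec_; ¬?)

[_⋯_] : ℕ → ℕ → List ℕ
[ a ⋯ b ] = applyUpTo (_+_ a) (suc b ∸ a)

_≐_ : List ℕ → List ℕ → Set
xs ≐ ys = xs ⊆ ys × ys ⊆ xs

swap : ℕ → ℕ → ℕ → ℕ
swap a b x = if does (x ≟ a) then b else if does (x ≟ b) then a else x

-- Finite sums of terms c·vᵏ, where v stands for q^{1/2}, listed as pairs (k , c).
Laurent : Set
Laurent = List (ℤ × ℤ)

coeff : Laurent → ℤ → ℤ
coeff f k = foldr ℤ._+_ ℤ.0ℤ (map proj₂ (filter (λ kc → proj₁ kc ℤ.≟ k) f))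

infix 4 _≈_
_≈_ : Laurent → Laurent → Set
f ≈ g = ∀ k → coeff f k ≡ coeff g k

monomial : ℤ → ℤ → Laurent
monomial c k = (k , c) ∷ []

0L 1L : Laurent
0L = []
1L = monomial ℤ.1ℤ ℤ.0ℤ

infixl 6 _+L_
_+L_ : Laurent → Laurent → Laurent
_+L_ = _++_

infixl 7 _*L_
_*L_ : Laurent → Laurent → Laurent
_*L_ = cartesianProductWith λ (k , c) (l , d) → (k ℤ.+ l , c ℤ.* d)

barL : Laurent → Laurent
barL = map λ (k , c) → (ℤ.- k , c)

record LabeledGraph (I : List ℕ) : Set₁ where
  field
    V   : Set
    m   : V → V → Laurent
    τ   : V → List ℕ
    τ⊆I : ∀ v → τ v ⊆ I

open LabeledGraph

_↓_ : ∀ {I} → LabeledGraph I → (J : List ℕ) → LabeledGraph J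
(Γ ↓ J) .V       = V Γ
(Γ ↓ J) .τ v     = filter (_∈? J) (τ Γ v)
(Γ ↓ J) .m u v   = if does ((Γ ↓ J) .τ u ⊆? (Γ ↓ J) .τ v) then 0L else m Γ u v
(Γ ↓ J) .τ⊆I v x = proj₂ (∈-filter⁻ (_∈? J) {xs = τ Γ v} x)

fullSubgraph : ∀ {I} (Γ : LabeledGraph I) → (V Γ → Set) → LabeledGraph I
fullSubgraph Γ P .V     = [ v ∈ V Γ ∣ P v ]
fullSubgraph Γ P .m u v = m Γ (value u) (value v)
fullSubgraph Γ P .τ v   = τ Γ (value v)
fullSubgraph Γ P .τ⊆I v = τ⊆I Γ (value v)

infix 4 _≅_
record _≅_ {I : List ℕ} (Γ Δ : LabeledGraph I) : Set where
  field
    to      : V Γ → V Δ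
    from    : V Δ → V Γ
    to-from : ∀ v → to (from v) ≡ v
    from-to : ∀ v → from (to v) ≡ v
    m-≈     : ∀ u v → m Γ u v ≈ m Δ (to u) (to v)
    τ-≐     : ∀ v → τ Γ v ≐ τ Δ (to v)

record TwoRowPartition (n : ℕ) : Set where
  field
    λ₁ λ₂ : ℕ
    λ₂≤λ₁ : λ₂ ≤ λ₁
    1≤λ₂  : 1 ≤ λ₂
    size  : λ₁ + λ₂ ≡ n

  n-nonZero : NonZero n
  n-nonZero = >-nonZero (subst (1 ≤_) size (≤-trans (≤-trans 1≤λ₂ λ₂≤λ₁) (m≤m+n λ₁ λ₂)))

module _ {n : ℕ} (sh : TwoRowPartition n) where
  open TwoRowPartition sh

  record RSYT : Set where
    field
      top    : Vec ℕ λ₁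
      bottom : Vec ℕ λ₂
      .top-increasing    : ∀ {a b} → a Fin.< b → lookup top a < lookup top b
      .bottom-increasing : ∀ {a b} → a Fin.< b → lookup bottom a < lookup bottom b
      .entries           : toList top ++ toList bottom ↭ [ 1 ⋯ n ]

    row¹ row² : List ℕ
    row¹ = toList top
    row² = toList bottom

  open RSYT

  Standard : RSYT → Set
  Standard T = ∀ (k : Fin λ₂) → lookup (top T) (inject≤ k λ₂≤λ₁) < lookup (bottom T) k

  SYT : Set
  SYT = [ T ∈ RSYT ∣ Standard T ]

  Interchange : ℕ → ℕ → RSYT → RSYT → Set
  Interchange a b s t =
    row¹ t ≡ InsertionSort.sort (map (swap a b) (row¹ s)) ×
    row² t ≡ InsertionSort.sort (map (swap a b) (row² s))

  interchange? : ∀ a b s t → Dec (Interchange a b s t)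
  interchange? a b s t = List.≡-dec _≟_ _ _ ×-dec List.≡-dec _≟_ _ _

  private instance
    n≢0 : NonZero n
    n≢0 = n-nonZero

  overline : ℤ → ℕ
  overline k = suc ((k ℤ.- + 1) %ℕ n)

  infixl 6 _⊞_ _⊟_
  _⊞_ _⊟_ : ℕ → ℕ → ℕ
  a ⊞ b = overline (+ a ℤ.+ + b)
  a ⊟ b = overline (+ a ℤ.- + b)

  -- Membership in the cyclic interval ⟨a,b⟩, for a, b, x in [1,n].
  _∈⟨_,_⟩ : ℕ → ℕ → ℕ → Set
  x ∈⟨ a , b ⟩ = a ≢ b ⊞ 1 × ((a ≤ b × a ≤ x × x ≤ b) ⊎ (b < a × (a ≤ x ⊎ x ≤ b)))

  ∈⟨_,_⟩? : ∀ a b x → Dec (x ∈⟨ a , b ⟩)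
  ∈⟨ a , b ⟩? x =
    ¬? (a ≟ b ⊞ 1) ×-dec
    ((a ≤? b ×-dec a ≤? x ×-dec x ≤? b) ⊎-dec (b <? a ×-dec (a ≤? x ⊎-dec x ≤? b)))

  #⟨_,_⟩ : ℕ → ℕ → List ℕ → ℕ
  #⟨ a , b ⟩ xs = length (filter ∈⟨ a , b ⟩? xs)

  Cyclic₁ : ℕ → RSYT → RSYT → Set
  Cyclic₁ i s t = i ∈ row¹ s × i ⊞ 1 ∈ row² s × Interchange i (i ⊞ 1) s t

  cyclic₁? : ∀ s t i → Dec (Cyclic₁ i s t)
  cyclic₁? s t i = i ∈? row¹ s ×-dec i ⊞ 1 ∈? row² s ×-dec interchange? i (i ⊞ 1) s t

  -- Truncated subtraction is harmless: j ⊟ i is either at least 3 or equal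
  -- to 1, and in the latter case the range of k is empty and j ≡ i ⊞ 1.
  Cyclic₂ : ℕ → ℕ → RSYT → RSYT → Set
  Cyclic₂ i j s t =
    (i ∈ row² s × j ∈ row¹ s × Interchange i j s t) ×
    i ≢ j ⊞ 1 ×
    (j ⊟ i) % 2 ≡ 1 ×
    (i ⊞ 1 ∈ row¹ s × j ⊟ 1 ∈ row² s) ×
    (i ⊟ 1 ∈ row¹ s ⊎ j ⊞ 1 ∈ row² s) ×
    All (λ k → k ≤ #⟨ j ⊟ (1 + 2 * k) , j ⊟ 2 ⟩ (row² s)) [ 1 ⋯ (j ⊟ i ∸ 3) / 2 ] ×
    (j ≢ i ⊞ 1 → #⟨ i ⊞ 2 , j ⊟ 2 ⟩ (row² s) ≡ (j ⊟ i ∸ 3) / 2)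

  cyclic₂? : ∀ s t i j → Dec (Cyclic₂ i j s t)
  cyclic₂? s t i j =
    (i ∈? row² s ×-dec j ∈? row¹ s ×-dec interchange? i j s t) ×-dec
    ¬? (i ≟ j ⊞ 1) ×-dec
    (j ⊟ i) % 2 ≟ 1 ×-dec
    (i ⊞ 1 ∈? row¹ s ×-dec j ⊟ 1 ∈? row² s) ×-dec
    (i ⊟ 1 ∈? row¹ s ⊎-dec j ⊞ 1 ∈? row² s) ×-dec
    all? (λ k → k ≤? _) _ ×-dec
    (¬? (j ≟ i ⊞ 1) →-dec (_ ≟ _))

  CyclicMove : RSYT → RSYT → Set
  CyclicMove s t =
    Any (λ i → Cyclic₁ i s t) [ 1 ⋯ n ] ⊎
    Any (λ i → Any (λ j → Cyclic₂ i j s t) [ 1 ⋯ n ]) [ 1 ⋯ n ]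

  cyclicMove? : ∀ s t → Dec (CyclicMove s t)
  cyclicMove? s t =
    any? (cyclic₁? s t) [ 1 ⋯ n ] ⊎-dec
    any? (λ i → any? (cyclic₂? s t i) [ 1 ⋯ n ]) [ 1 ⋯ n ]

  higher? : ∀ T i → Dec (i ∈ row¹ T × i ⊞ 1 ∈ row² T)
  higher? T i = i ∈? row¹ T ×-dec i ⊞ 1 ∈? row² T

  desBar des : RSYT → List ℕ
  desBar T = filter (higher? T) [ 1 ⋯ n ]
  des T    = filter (λ i → ¬? (i ≟ n)) (desBar T)

  ΓBar : LabeledGraph [ 1 ⋯ n ]
  ΓBar .V       = RSYT
  ΓBar .m s t   = if does (cyclicMove? s t) then 1L else 0L
  ΓBar .τ       = desBar
  ΓBar .τ⊆I T x = proj₁ (∈-filter⁻ (higher? T) {xs = [ 1 ⋯ n ]} x)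

  -- The W-graph of a left cell of shape sh determines its vertex set only up to
  -- isomorphism; this is its realization on standard tableaux.
  Γ : LabeledGraph [ 1 ⋯ n ∸ 1 ]
  Γ = fullSubgraph (ΓBar ↓ [ 1 ⋯ n ∸ 1 ]) Standard

  Γ-τ : ∀ T → τ Γ T ≐ des (value T)
  Γ-τ T = ⊆des , des⊆
    where
    D = desBar (value T)

    ⊆des : τ Γ T ⊆ des (value T)
    ⊆des x with ∈-filter⁻ (_∈? [ 1 ⋯ n ∸ 1 ]) {xs = D} x
    ... | x∈D , x∈I with ∈-applyUpTo⁻ suc x∈I
    ...   | k , k<n-1 , refl = ∈-filter⁺ _ x∈D (λ e → ℕ.<-irrefl (cong (_∸ 1) e) k<n-1)

    des⊆ : des (value T) ⊆ τ Γ T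
    des⊆ x with ∈-filter⁻ (λ i → ¬? (i ≟ n)) {xs = D} x
    ... | x∈D , x≢n with ∈-applyUpTo⁻ suc (τ⊆I ΓBar (value T) x∈D)
    ...   | k , k<n , refl = ∈-filter⁺ _ x∈D (∈-applyUpTo⁺ suc (ℕ.pred-mono-≤ (≤∧≢⇒< k<n x≢n)))

  #[_,_] : ℕ → ℕ → List ℕ → ℕ
  #[ a , b ] xs = length (filter (λ α → a ≤? α ×-dec α ≤? b) xs)

  FirstMove : SYT → SYT → Set
  FirstMove s t = ∃[ i ]
    1 ≤ i × i ≤ n ∸ 1 ×
    i ∈ row¹ (value s) × i + 1 ∈ row² (value s) ×
    Interchange i (i + 1) (value s) (value t)

  -- The entries of s lie in [1,n], so j + 1 ∈ row² fails for j ≡ n.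
  SecondMove : SYT → SYT → Set
  SecondMove s t = ∃₂ λ i j →
    (i ∈ row² (value s) × j ∈ row¹ (value s) × Interchange i j (value s) (value t)) ×
    (1 < i × i < j × j ≤ n × (j ∸ i) % 2 ≡ 1) ×
    (i + 1 ∈ row¹ (value s) × j ∸ 1 ∈ row² (value s)) ×
    (i ∸ 1 ∈ row¹ (value s) ⊎ j + 1 ∈ row² (value s)) ×
    (∀ k → 1 ≤ k → k ≤ (j ∸ i ∸ 3) / 2 → k ≤ #[ j ∸ 1 ∸ 2 * k , j ∸ 2 ] (row² (value s))) ×
    (j ≢ i + 1 → #[ i + 2 , j ∸ 2 ] (row² (value s)) ≡ (j ∸ i ∸ 3) / 2)

  record GivenByMoves (w : SYT → SYT → Laurent) : Set where
    field
      first     : ∀ s t → FirstMove s t → w s t ≈ 1L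
      second    : ∀ s t → SecondMove s t → w s t ≈ 1L
      otherwise : ∀ s t → ¬ FirstMove s t → ¬ SecondMove s t → w s t ≈ 0L

-- Elements of the symmetric group in one-line notation, with 0-based values.
Perm : ℕ → Set
Perm n = [ w ∈ Vec (Fin n) n ∣ Injective _≡_ _≡_ (lookup w) ]

module _ {n : ℕ} where

  _≟P_ : (x y : Perm n) → Dec (x ≡ y)
  _≟P_ = Refinement._≟_ (Vec.≡-dec Fin._≟_)

  transpose-injective : ∀ a b → Injective _≡_ _≡_ (transpose {n} a b)
  transpose-injective a b e =
    trans (sym (transpose-inverse b a)) (trans (cong (transpose b a) e) (transpose-inverse b a))

  map-injective : ∀ {f : Fin n → Fin n} {w : Vec (Fin n) n} → Injective _≡_ _≡_ f →
                  Injective _≡_ _≡_ (lookup w) → Injective _≡_ _≡_ (lookup (Vec.map f w))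
  map-injective {f} {w} f-inj w-inj {x} {y} e = w-inj (f-inj
    (trans (sym (Vec.lookup-map x f w)) (trans e (Vec.lookup-map y f w))))

  -- Left multiplication by the transposition (a b), acting on values.
  reflect : Fin n → Fin n → Perm n → Perm n
  reflect a b (w , [ inj ]) =
    Vec.map (transpose a b) w , [ map-injective {w = w} (transpose-injective a b) inj ]

  inverted? : ∀ (w : Perm n) (ab : Fin n × Fin n) →
              Dec (proj₁ ab Fin.< proj₂ ab × lookup (value w) (proj₂ ab) Fin.< lookup (value w) (proj₁ ab))
  inverted? w (a , b) = a Fin.<? b ×-dec lookup (value w) b Fin.<? lookup (value w) a

  ℓ : Perm n → ℕ
  ℓ w = length (filter (inverted? w) (cartesianProduct (allFin n) (allFin n)))

  Bruhat : Perm n → Perm n → Set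
  Bruhat = Star λ x y → ∃₂ λ a b → y ≡ reflect a b x × ℓ x < ℓ y

-- Fin (pred n) indexes the simple reflections: i stands for s_{i+1}.
infixr 8 _◂_
_◂_ : ∀ {n} → Fin (pred n) → Perm n → Perm n
_◂_ {suc n} i = reflect (inject₁ i) (Fin.suc i)

label : ∀ {n} → Fin n → ℕ
label i = suc (toℕ i)

module _ {n : ℕ} where

  leftDescent? : ∀ (w : Perm n) i → Dec (ℓ (i ◂ w) < ℓ w)
  leftDescent? w i = ℓ (i ◂ w) <? ℓ w

  leftDescents : Perm n → List ℕ
  leftDescents w = map label (filter (leftDescent? w) (allFin (pred n)))

-- Elements of the Hecke algebra: formal sums of terms f·T_w, with
-- (T_s + 1)(T_s - q) = 0.
Hecke : ℕ → Set
Hecke n = List (Laurent × Perm n)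

q q⁻¹ -1L : Laurent
q   = monomial ℤ.1ℤ (+ 2)
q⁻¹ = monomial ℤ.1ℤ (ℤ.- + 2)
-1L = monomial ℤ.-1ℤ ℤ.0ℤ

module _ {n : ℕ} where

  infix 4 _≈H_
  infixl 7 _·_

  [_]T_ : Hecke n → Perm n → Laurent
  [ h ]T w = foldr _+L_ 0L (map proj₁ (filter (λ fx → proj₂ fx ≟P w) h))

  _≈H_ : Hecke n → Hecke n → Set
  g ≈H h = ∀ w → [ g ]T w ≈ [ h ]T w

  _·_ : Laurent → Hecke n → Hecke n
  f · h = map (λ (g , w) → (f *L g , w)) h

  Tˢ : Fin (pred n) → Hecke n → Hecke n
  Tˢ i = concatMap λ (f , w) →
    if does (leftDescent? w i)
      then (f *L (q +L -1L) , w) ∷ (f *L q , i ◂ w) ∷ []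
      else (f , i ◂ w) ∷ []

  -- T_s⁻¹ = q⁻¹ T_s + (q⁻¹ - 1)
  Tˢ⁻¹ : Fin (pred n) → Hecke n → Hecke n
  Tˢ⁻¹ i h = q⁻¹ · Tˢ i h ++ (q⁻¹ +L -1L) · h

  -- The bar involution on T_w, as T_{s₁}⁻¹ ⋯ T_{sₖ}⁻¹ for a reduced expression
  -- w = s₁ ⋯ sₖ obtained by splitting off the smallest left descent k = ℓ w times.
  barT : ℕ → Perm n → Hecke n
  barT zero    w = (1L , w) ∷ []
  barT (suc k) w with filter (leftDescent? w) (allFin (pred n))
  ... | []    = (1L , w) ∷ []
  ... | i ∷ _ = Tˢ⁻¹ i (barT k (i ◂ w))

  barH : Hecke n → Hecke n
  barH = concatMap λ (f , w) → barL f · barT (ℓ w) w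

-- The basis C′_w = q^{-ℓ(w)/2} Σ_{y ≤ w} P_{y,w} T_y, which is unique.
record KazhdanLusztigBasis (n : ℕ) : Set where
  field
    C′ : Perm n → Hecke n

  P : Perm n → Perm n → Laurent
  P y w = monomial ℤ.1ℤ (+ ℓ w) *L ([ C′ w ]T y)

  field
    bar-invariant : ∀ w → barH (C′ w) ≈H C′ w
    support       : ∀ y w → ¬ Bruhat y w → P y w ≈ 0L
    diagonal      : ∀ w → P w w ≈ 1L
    -- P y w is a polynomial in q of degree at most (ℓ(w) - ℓ(y) - 1)/2.
    degree        : ∀ y w → y ≢ w → ∀ k → coeff (P y w) k ≢ ℤ.0ℤ →
                    ∃[ d ] k ≡ + (2 * d) × ℓ y + (2 * d + 1) ≤ ℓ w

  -- The coefficient of q^{(ℓ(w) - ℓ(y) - 1)/2} = v^{ℓ(w) - ℓ(y) - 1} in P y w.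
  topCoeff : Perm n → Perm n → ℤ
  topCoeff y w = coeff (P y w) (+ ℓ w ℤ.- + ℓ y ℤ.- + 1)

  μ : Perm n → Perm n → ℤ
  μ x y = if does (ℓ x ≤? ℓ y) then topCoeff x y else topCoeff y x

  _≤L_ : Perm n → Perm n → Set
  _≤L_ = Star λ x y → μ x y ≢ ℤ.0ℤ × ¬ (leftDescents x ⊆ leftDescents y)

  _~L_ : Perm n → Perm n → Set
  x ~L y = x ≤L y × y ≤L x

-- Schensted insertion into a row; the second component is the bumped letter.
insertRow : ℕ → List ℕ → List ℕ × Maybe ℕ
insertRow x []       = x ∷ [] , nothing
insertRow x (y ∷ ys) with does (x <? y)
... | true  = x ∷ ys , just y
... | false = let ys′ , bumped = insertRow x ys in y ∷ ys′ , bumped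

insertTableau : List (List ℕ) → ℕ → List (List ℕ)
insertTableau []       x = (x ∷ []) ∷ []
insertTableau (r ∷ rs) x with insertRow x r
... | r′ , nothing = r′ ∷ rs
... | r′ , just y  = r′ ∷ insertTableau rs y

rsShape : ∀ {n} → Perm n → List ℕ
rsShape w = map length (foldl insertTableau [] (map label (toList (value w))))

module _ {n : ℕ} (kl : KazhdanLusztigBasis n) where
  open KazhdanLusztigBasis kl

  reducedWGraph : LabeledGraph [ 1 ⋯ n ∸ 1 ]
  reducedWGraph .V       = Perm n
  reducedWGraph .m u v   = if does (leftDescents u ⊆? leftDescents v) then 0L else monomial (μ u v) ℤ.0ℤ
  reducedWGraph .τ       = leftDescents
  reducedWGraph .τ⊆I w x =
    let i , _ , eq = ∈-map⁻ label x
    in subst (_∈ [ 1 ⋯ n ∸ 1 ]) (sym eq) (∈-applyUpTo⁺ suc (Fin.toℕ<n i))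

  leftCellGraph : Perm n → LabeledGraph [ 1 ⋯ n ∸ 1 ]
  leftCellGraph w₀ = fullSubgraph reducedWGraph (_~L w₀)

  HasShape : Perm n → TwoRowPartition n → Set
  HasShape w₀ sh = ∀ w → w ~L w₀ → rsShape w ≡ TwoRowPartition.λ₁ sh ∷ TwoRowPartition.λ₂ sh ∷ []

{-# OPTIONS --safe #-}

-- A cyclic move between standard tableaux s, t never wraps around n. If it did, then
-- either n ∈ s¹ and 1 ∈ s², or the move is of the second kind with j < i. In the latter
-- case condition (d), applied to the longest interval [j-1-2k, j-2] of positive integers,
-- together with j-1 ∈ s² and j ∈ t² puts more than j/2 of the entries 1, …, j of t into the
-- second row. For non-wrapping moves the cyclic conditions are the linear ones, and
-- des(s) ⊄ des(t) is automatic: i, i-1 or j is lost from the descent set.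
module Submission where

open import Data.Nat.Properties as ℕ
open import Data.Bool.Base using (if_then_else_)
open import Data.Bool.Properties using (if-eta)
open import Data.Empty using (⊥; ⊥-elim; ⊥-elim-irr)
open import Data.Fin.Base as Fin using (Fin; inject≤)
open import Data.Integer.Base as ℤ using (+_)
import Data.Integer.Properties as ℤ
open import Data.Irrelevant using ([_])
open import Data.List.Base using (List; []; _∷_; _++_; map; filter; length; applyUpTo)
open import Data.List.Membership.DecPropositional ℕ._≟_ using (_∈_; _∈?_)
open import Data.List.Membership.Propositional using (find; lose)
open import Data.List.Membership.Propositional.Properties
open import Data.List.Properties using (filter-++; filter-some; filter-≐; length-++)
open import Data.List.Relation.Binary.Permutation.Propositional using (↭-sym; ↭⇒↭ₛ)
open import Data.List.Relation.Binary.Permutation.Propositional.Properties using (∈-resp-↭; filter-↭; ↭-length)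
import Data.List.Relation.Binary.Permutation.Setoid.Properties as Permutation
open import Data.List.Relation.Binary.Subset.DecPropositional ℕ._≟_ using (_⊆_; _⊆?_)
open import Data.List.Relation.Unary.All as All using (All)
open import Data.List.Relation.Unary.AllPairs using (_∷_)
open import Data.List.Relation.Unary.Any using (here; there)
open import Data.List.Relation.Unary.Unique.Propositional using (Unique)
open import Data.List.Relation.Unary.Unique.Propositional.Properties using (applyUpTo⁺₁)
import Data.List.Sort.InsertionSort.Properties as InsertionSort
open import Data.Nat
open import Data.Nat.DivMod
open import Data.Product.Base using (_×_; _,_; proj₁; proj₂)
open import Data.Refinement using (value; _,_)
open import Data.Sum.Base as Sum using (_⊎_; inj₁; inj₂)
open import Data.Vec.Base as Vec using (Vec; lookup; toList)
open import Function.Base using (_∘_)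
open import Relation.Binary.Definitions using (tri<; tri≈; tri>)
open import Relation.Binary.PropositionalEquality
open import Relation.Nullary using (¬_; Dec; yes; no; does; contradiction)
open import Relation.Nullary.Decidable using (dec-true; dec-false; recompute)
open import Relation.Unary using (Pred; Decidable)
open import Defs

-- Transpositions of entries, disjoint lists and integer ranges.

swap-first : ∀ a b → swap a b a ≡ b
swap-first a b rewrite dec-true (a ≟ a) refl = refl

swap-second : ∀ a b → swap a b b ≡ a
swap-second a b with b ≟ a
... | yes b≡a rewrite dec-true (b ≟ a) b≡a = b≡a
... | no  b≢a rewrite dec-false (b ≟ a) b≢a | dec-true (b ≟ b) refl = refl

swap-other : ∀ {a b x} → x ≢ a → x ≢ b → swap a b x ≡ x
swap-other {a} {b} {x} x≢a x≢b
  rewrite dec-false (x ≟ a) x≢a | dec-false (x ≟ b) x≢b = refl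

++-unique⇒disjoint : ∀ {xs ys : List ℕ} {x} → Unique (xs ++ ys) → x ∈ xs → x ∈ ys → ⊥
++-unique⇒disjoint {xs = _ ∷ xs} (x∉ ∷ _) (here refl) x∈ys =
  All.lookup x∉ (∈-++⁺ʳ xs x∈ys) refl
++-unique⇒disjoint {xs = _ ∷ _} (_ ∷ u) (there x∈xs) x∈ys = ++-unique⇒disjoint u x∈xs x∈ys

∈-[⋯]⁺ : ∀ {x m} → 1 ≤ x → x ≤ m → x ∈ [ 1 ⋯ m ]
∈-[⋯]⁺ {suc x} _ x≤m = ∈-applyUpTo⁺ suc x≤m

∈-[⋯]⁻ : ∀ {x m} → x ∈ [ 1 ⋯ m ] → 1 ≤ x × x ≤ m
∈-[⋯]⁻ x∈ with ∈-applyUpTo⁻ suc x∈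
... | _ , k<m , refl = s≤s z≤n , k<m

-- Counting list entries by predicates and upper bounds.

module _ {p q} {P : Pred ℕ p} {Q : Pred ℕ q} (P? : Decidable P) (Q? : Decidable Q)
         (P⇒Q : ∀ {x} → P x → Q x) where

  count-mono-≤ : ∀ xs → length (filter P? xs) ≤ length (filter Q? xs)
  count-mono-≤ [] = z≤n
  count-mono-≤ (x ∷ xs) with P? x | Q? x
  ... | yes _  | yes _  = s≤s (count-mono-≤ xs)
  ... | yes px | no ¬qx = contradiction (P⇒Q px) ¬qx
  ... | no _   | yes _  = m≤n⇒m≤1+n (count-mono-≤ xs)
  ... | no _   | no _   = count-mono-≤ xs

  -- Serves to gain one further entry `x` each time a counting predicate is weakened.
  count-mono-< : ∀ {x xs} → x ∈ xs → ¬ P x → Q x → length (filter P? xs) < length (filter Q? xs)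
  count-mono-< {x} {_ ∷ xs} (here refl) ¬px qx with P? x | Q? x
  ... | yes px | _      = contradiction px ¬px
  ... | no _   | no ¬qx = contradiction qx ¬qx
  ... | no _   | yes _  = s≤s (count-mono-≤ xs)
  count-mono-< {xs = y ∷ xs} (there x∈xs) ¬px qx with P? y | Q? y
  ... | yes _  | yes _  = s≤s (count-mono-< x∈xs ¬px qx)
  ... | yes py | no ¬qy = contradiction (P⇒Q py) ¬qy
  ... | no _   | yes _  = m≤n⇒m≤1+n (count-mono-< x∈xs ¬px qx)
  ... | no _   | no _   = count-mono-< x∈xs ¬px qx

count-map : ∀ {p} {P : Pred ℕ p} (P? : Decidable P) (f : ℕ → ℕ) xs →
            length (filter P? (map f xs)) ≡ length (filter (P? ∘ f) xs)
count-map P? f [] = refl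
count-map P? f (x ∷ xs) with P? (f x)
... | yes _ = cong suc (count-map P? f xs)
... | no  _ = count-map P? f xs

#≤ : ℕ → List ℕ → ℕ
#≤ x xs = length (filter (_≤? x) xs)

-- If `f k ≤ x` then `a + k ≤ x`, and `suc x ∸ a` bounds the number of such `k`. The offset `a` is
-- variable so that the induction can pass to `suc a` and `f ∘ suc`; ranges starting at 1 are the
-- case `a = 1`, `f = suc`.
#≤-applyUpTo : ∀ x a f m → (∀ k → a + k ≤ f k) → #≤ x (applyUpTo f m) ≤ suc x ∸ a
#≤-applyUpTo x a f zero    _    = z≤n
#≤-applyUpTo x a f (suc m) a+k≤
  with f 0 ≤? x
     | #≤-applyUpTo x (suc a) (f ∘ suc) m (λ k → subst (_≤ f (suc k)) (+-suc a k) (a+k≤ (suc k)))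
... | no  f0≰x | ih rewrite dec-false (f 0 ≤? x) f0≰x = ≤-trans ih (∸-monoʳ-≤ (suc x) (n≤1+n a))
... | yes f0≤x | ih rewrite dec-true (f 0 ≤? x) f0≤x = begin
  suc (#≤ x (applyUpTo (f ∘ suc) m)) ≤⟨ s≤s ih ⟩
  -- No truncation occurs here, because `a ≤ f 0 ≤ x`.
  suc (x ∸ a)                        ≡⟨ +-∸-assoc 1 (≤-trans (m+n≤o⇒m≤o a (a+k≤ 0)) f0≤x) ⟨
  suc x ∸ a                          ∎
  where open ≤-Reasoning

-- Each entry of `ys` that is at most `x` lies below a smaller entry of `xs` in the same column.
#≤-dominated : ∀ {k l} (l≤k : l ≤ k) (xs : Vec ℕ k) (ys : Vec ℕ l) →
               (∀ i → lookup xs (inject≤ i l≤k) < lookup ys i) →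
               ∀ x → #≤ x (toList ys) ≤ #≤ x (toList xs)
#≤-dominated l≤k       xs            Vec.[]        xs<ys x = z≤n
#≤-dominated (s≤s l≤k) (a Vec.∷ xs) (b Vec.∷ ys) xs<ys x with a ≤? x | b ≤? x
... | yes a≤x | yes b≤x rewrite dec-true (a ≤? x) a≤x | dec-true (b ≤? x) b≤x =
  s≤s (#≤-dominated l≤k xs ys (xs<ys ∘ Fin.suc) x)
... | yes a≤x | no b≰x rewrite dec-true (a ≤? x) a≤x | dec-false (b ≤? x) b≰x =
  m≤n⇒m≤1+n (#≤-dominated l≤k xs ys (xs<ys ∘ Fin.suc) x)
... | no a≰x | yes b≤x = contradiction (≤-trans (<⇒≤ (xs<ys Fin.zero)) b≤x) a≰x
... | no a≰x | no b≰x rewrite dec-false (a ≤? x) a≰x | dec-false (b ≤? x) b≰x =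
  #≤-dominated l≤k xs ys (xs<ys ∘ Fin.suc) x

-- Rows of a tableau and the ballot condition.

module _ {n : ℕ} (sh : TwoRowPartition n) where
  open TwoRowPartition sh
  open RSYT {n} {sh}

  private
    infixl 6 _⊕_ _⊖_
    _⊕_ _⊖_ : ℕ → ℕ → ℕ
    _⊕_ = _⊞_ sh
    _⊖_ = _⊟_ sh

  -- The field `entries` is irrelevant, so the bounds are rebuilt from a decidable membership by
  -- `recompute`.
  entry-bounds : ∀ (T : RSYT sh) {x} → x ∈ row¹ T ⊎ x ∈ row² T → 1 ≤ x × x ≤ n
  entry-bounds T@record { entries = π } {x} x∈ =
    ∈-[⋯]⁻ (recompute (x ∈? [ 1 ⋯ n ]) (∈-resp-↭ π (join x∈)))
    where
    join : x ∈ row¹ T ⊎ x ∈ row² T → x ∈ row¹ T ++ row² T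
    join (inj₁ x∈¹) = ∈-++⁺ˡ x∈¹
    join (inj₂ x∈²) = ∈-++⁺ʳ (row¹ T) x∈²

  rows-disjoint : ∀ (T : RSYT sh) {x} → x ∈ row¹ T → x ∈ row² T → ⊥
  rows-disjoint T@record { entries = π } x∈¹ x∈² = ⊥-elim-irr (++-unique⇒disjoint
    (Permutation.Unique-resp-↭ (setoid ℕ) (↭⇒↭ₛ (↭-sym π))
      (applyUpTo⁺₁ suc n (λ i<j _ e → <⇒≢ i<j (suc-injective e))))
    x∈¹ x∈²)

  -- Column by column, `row¹` has at least as many entries up to `x` as `row²`, and both rows
  -- together have at most `x` of them. Standardness enters all later arguments through this
  -- inequality.
  ballot : ∀ (T : RSYT sh) → .(Standard sh T) → ∀ x → #≤ x (row² T) + #≤ x (row² T) ≤ x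
  ballot T@record { entries = π } std x = recompute (_ ≤? _) (begin
    #≤ x (row² T) + #≤ x (row² T)  ≤⟨ +-monoˡ-≤ _ (#≤-dominated λ₂≤λ₁ (top T) (bottom T) std x) ⟩
    #≤ x (row¹ T) + #≤ x (row² T)  ≡⟨ length-++ (filter (_≤? x) (row¹ T)) ⟨
    length (filter (_≤? x) (row¹ T) ++ filter (_≤? x) (row² T))
                                   ≡⟨ cong length (filter-++ (_≤? x) (row¹ T) (row² T)) ⟨
    #≤ x (row¹ T ++ row² T)        ≡⟨ ↭-length (filter-↭ (_≤? x) π) ⟩
    #≤ x [ 1 ⋯ n ]                 ≤⟨ #≤-applyUpTo x 1 suc n (λ _ → ≤-refl) ⟩
    x                              ∎)
    where open ≤-Reasoning

  -- Otherwise the ballot inequality at 1 would read `2 ≤ 1`.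
  1∉row² : ∀ (T : RSYT sh) → .(Standard sh T) → ¬ 1 ∈ row² T
  1∉row² T std 1∈ = <⇒≱ {1} (s≤s (s≤s z≤n)) (≤-trans (+-mono-≤ 1≤# 1≤#) (ballot T std 1))
    where
    1≤# : 1 ≤ #≤ 1 (row² T)
    1≤# = filter-some (_≤? 1) (lose 1∈ ≤-refl)

  -- Effect of an interchange on rows; re-sorting only permutes them.

  module _ a b (s t : RSYT sh) (st : Interchange sh a b s t) where

    interchange-∈row¹ : ∀ {x} → x ∈ row¹ s → swap a b x ∈ row¹ t
    interchange-∈row¹ x∈ = subst (_ ∈_) (sym (proj₁ st))
      (∈-resp-↭ (↭-sym (InsertionSort.sort-↭ ≤-decTotalOrder _)) (∈-map⁺ (swap a b) x∈))

    interchange-∈row² : ∀ {x} → x ∈ row² s → swap a b x ∈ row² t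
    interchange-∈row² x∈ = subst (_ ∈_) (sym (proj₂ st))
      (∈-resp-↭ (↭-sym (InsertionSort.sort-↭ ≤-decTotalOrder _)) (∈-map⁺ (swap a b) x∈))

    interchange-first∈row¹ : b ∈ row¹ s → a ∈ row¹ t
    interchange-first∈row¹ = subst (_∈ row¹ t) (swap-second a b) ∘ interchange-∈row¹

    interchange-first∈row² : b ∈ row² s → a ∈ row² t
    interchange-first∈row² = subst (_∈ row² t) (swap-second a b) ∘ interchange-∈row²

    interchange-second∈row² : a ∈ row² s → b ∈ row² t
    interchange-second∈row² = subst (_∈ row² t) (swap-first a b) ∘ interchange-∈row²

    -- Pulls a count in `t` back to the list `row² s`, where it can be compared with other counts by
    -- comparing predicates.
    #≤-interchange : ∀ x → #≤ x (row² t) ≡ length (filter (λ y → swap a b y ≤? x) (row² s))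
    #≤-interchange x = trans (cong (#≤ x) (proj₂ st)) (trans
      (↭-length (filter-↭ (_≤? x) (InsertionSort.sort-↭ ≤-decTotalOrder (map (swap a b) (row² s)))))
      (count-map (_≤? x) (swap a b) (row² s)))

  private instance
    n≢0 : NonZero n
    n≢0 = n-nonZero

  -- Cyclic arithmetic and cyclic intervals in linear terms.

  overline-id : ∀ {x} → 1 ≤ x → x ≤ n → overline sh (+ x) ≡ x
  overline-id {suc x} _ x<n = cong suc (m<n⇒m%n≡m x<n)

  ⊕-linear : ∀ a b → 1 ≤ b → a + b ≤ n → a ⊕ b ≡ a + b
  ⊕-linear a b 1≤b = overline-id (≤-trans 1≤b (m≤n+m b a))

  n⊕1≡1 : n ⊕ 1 ≡ 1
  n⊕1≡1 = trans (cong (λ m → overline sh (+ m)) (+-comm n 1)) (cong suc (n%n≡0 n))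

  ⊖-linear : ∀ {a b} → b < a → a ≤ n → a ⊖ b ≡ a ∸ b
  ⊖-linear {a} {b} b<a a≤n = trans
    (cong (overline sh) (trans (ℤ.m-n≡m⊖n a b) (ℤ.⊖-≥ (<⇒≤ b<a))))
    (overline-id (m<n⇒0<n∸m b<a) (≤-trans (m∸n≤m a b) a≤n))

  -- `overline` subtracts 1 before reducing, so the residue involved is that of `suc x`, which the
  -- bound `suc x < n` keeps reduced.
  overline-negative : ∀ {x} → 1 ≤ x → suc x < n → overline sh (ℤ.- + x) ≡ n ∸ x
  overline-negative {suc x} _ x+2<n
    rewrite +-identityʳ x | m<n⇒m%n≡m x+2<n = sym (+-∸-assoc 1 (<⇒≤ x+2<n))

  ⊖-wrapping : ∀ {i j} → 2 ≤ j → j < i → i ≤ n → j ⊖ i ≡ n ∸ (i ∸ j)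
  ⊖-wrapping {i} {j} 2≤j j<i i≤n = trans
    (cong (overline sh) (trans (ℤ.m-n≡m⊖n j i) (ℤ.⊖-< j<i)))
    (overline-negative (m<n⇒0<n∸m j<i) (begin-strict
      suc (i ∸ j)   <⟨ n<1+n _ ⟩
      2 + (i ∸ j)   ≤⟨ +-monoˡ-≤ (i ∸ j) 2≤j ⟩
      j + (i ∸ j)   ≡⟨ m+[n∸m]≡n (<⇒≤ j<i) ⟩
      i             ≤⟨ i≤n ⟩
      n             ∎))
    where open ≤-Reasoning

  -- For a ≡ b + 1 both sides are empty.
  #⟨⟩-linear : ∀ {a b} xs → a ≤ b + 1 → b < n → #⟨_,_⟩ sh a b xs ≡ #[_,_] sh a b xs
  #⟨⟩-linear {a} {b} xs a≤b+1 b<n = cong length (filter-≐ (∈⟨_,_⟩? sh a b) _ (to , from) xs)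
    where
    b⊕1≡b+1 : b ⊕ 1 ≡ b + 1
    b⊕1≡b+1 = ⊕-linear b 1 ≤-refl (subst (_≤ n) (+-comm 1 b) b<n)

    to : ∀ {x} → _∈⟨_,_⟩ sh x a b → a ≤ x × x ≤ b
    to (_ , inj₁ (_ , a≤x≤b))  = a≤x≤b
    to (a≢ , inj₂ (b<a , _))   =
      contradiction (trans (≤-antisym a≤b+1 (subst (_≤ a) (+-comm 1 b) b<a)) (sym b⊕1≡b+1)) a≢

    from : ∀ {x} → a ≤ x × x ≤ b → _∈⟨_,_⟩ sh x a b
    from (a≤x , x≤b) = (λ e → <⇒≱ (n<1+n b) (subst (_≤ b) (trans e (trans b⊕1≡b+1 (+-comm b 1))) a≤b))
                     , inj₁ (a≤b , a≤x , x≤b)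
      where
      a≤b : a ≤ b
      a≤b = ≤-trans a≤x x≤b

  -- Common form of conditions (d) and (e), whose intervals both end at `j ⊖ 2`. The bound
  -- `a ≤ j ∸ 1` admits the empty interval.
  #⟨⟩-below : ∀ {a a′ j} xs → a′ ≡ a → a ≤ j ∸ 1 → 2 < j → j ≤ n →
              #⟨_,_⟩ sh a′ (j ⊖ 2) xs ≡ #[_,_] sh a (j ∸ 2) xs
  #⟨⟩-below {a} {j = j} xs a′≡a a≤j-1 2<j j≤n = trans
    (cong₂ (λ a b → #⟨_,_⟩ sh a b xs) a′≡a (⊖-linear 2<j j≤n))
    (#⟨⟩-linear xs (begin
      a               ≤⟨ a≤j-1 ⟩
      j ∸ 1           ≤⟨ m≤n+m∸n (j ∸ 1) 1 ⟩
      1 + (j ∸ 1 ∸ 1) ≡⟨ cong suc (∸-+-assoc j 1 1) ⟩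
      1 + (j ∸ 2)     ≡⟨ +-comm 1 _ ⟩
      j ∸ 2 + 1       ∎)
      (<-≤-trans (∸-monoʳ-< (s≤s z≤n) (<⇒≤ 2<j)) j≤n))
    where open ≤-Reasoning

  -- The interval of condition (d) is linear as soon as its lower end is positive, whether or not
  -- the move itself wraps.
  #⟨⟩-ballot : ∀ {j} k xs → 1 + 2 * k < j → 2 < j → j ≤ n →
               #⟨_,_⟩ sh (j ⊖ (1 + 2 * k)) (j ⊖ 2) xs ≡ #[_,_] sh (j ∸ 1 ∸ 2 * k) (j ∸ 2) xs
  #⟨⟩-ballot {j} k xs 1+2k<j 2<j j≤n = #⟨⟩-below xs
    (trans (⊖-linear 1+2k<j j≤n) (sym (∸-+-assoc j 1 (2 * k)))) (m∸n≤m (j ∸ 1) (2 * k)) 2<j j≤n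

  -- Exclusion of wrapping moves of the second kind.

  cyclic₂-wrapping-nonstandard : ∀ {i j} (s t : RSYT sh) → Cyclic₂ sh i j s t → j < i →
                                 ¬ Standard sh t
  cyclic₂-wrapping-nonstandard {i} {j} s t
    ((i∈² , j∈¹ , st) , _ , odd , (_ , j⊖1∈²) , _ , dense , _) j<i std = <⇒≱ (n<1+n (3 + k * 2)) (begin
    -- Two bounds on `j` collide: the ballot condition for `t` gives `4 + 2k ≤ j`, while the choice
    -- of `k` gives `j ≤ 3 + 2k`.
    (2 + k) * 2                     ≡⟨ trans (*-comm (2 + k) 2) (cong (λ x → 2 + k + x) (+-identityʳ (2 + k))) ⟩
    (2 + k) + (2 + k)               ≤⟨ +-mono-≤ 2+k≤# 2+k≤# ⟩
    #≤ j (row² t) + #≤ j (row² t)   ≤⟨ ballot t std j ⟩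
    j                               ≤⟨ j≤3+2k ⟩
    3 + k * 2                       ∎)
    where
    open ≤-Reasoning

    i≤n : i ≤ n
    i≤n = proj₂ (entry-bounds s (inj₂ i∈²))

    j≤n : j ≤ n
    j≤n = proj₂ (entry-bounds s (inj₁ j∈¹))

    -- For `j ≡ 1` the interchange would put 1 into `row² t`.
    2≤j : 2 ≤ j
    2≤j = ≤∧≢⇒< (proj₁ (entry-bounds s (inj₁ j∈¹)))
      λ 1≡j → 1∉row² t std (subst (_∈ row² t) (sym 1≡j) (interchange-second∈row² i j s t st i∈²))

    -- The largest `k` for which the lower end `j - 1 - 2k` is still positive.
    k : ℕ
    k = (j ∸ 2) / 2

    2+2k≤j : 2 + k * 2 ≤ j
    2+2k≤j = begin
      2 + k * 2   ≤⟨ +-monoʳ-≤ 2 (m/n*n≤m (j ∸ 2) 2) ⟩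
      2 + (j ∸ 2) ≡⟨ m+[n∸m]≡n 2≤j ⟩
      j           ∎

    j≤3+2k : j ≤ 3 + k * 2
    j≤3+2k = begin
      j                         ≡⟨ m+[n∸m]≡n 2≤j ⟨
      2 + (j ∸ 2)               ≡⟨ cong (λ x → 2 + x) (m≡m%n+[m/n]*n (j ∸ 2) 2) ⟩
      2 + ((j ∸ 2) % 2 + k * 2) ≤⟨ +-monoʳ-≤ 2 (+-monoˡ-≤ (k * 2) (≤-pred (m%n<n (j ∸ 2) 2))) ⟩
      3 + k * 2                 ∎

    -- The wrapping distance is `n - (i - j)`, and `i ≤ n`.
    j≤j⊖i : j ≤ j ⊖ i
    j≤j⊖i = begin
      j           ≡⟨ m∸[m∸n]≡n (<⇒≤ j<i) ⟨
      i ∸ (i ∸ j) ≤⟨ ∸-monoˡ-≤ (i ∸ j) i≤n ⟩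
      n ∸ (i ∸ j) ≡⟨ ⊖-wrapping 2≤j j<i i≤n ⟨
      j ⊖ i       ∎

    -- `2 + k * 2` is even and `j ⊖ i` is odd, so the inequality between them is strict. This makes
    -- `k` admissible in condition (d).
    3+2k≤j⊖i : 3 + k * 2 ≤ j ⊖ i
    3+2k≤j⊖i = ≤∧≢⇒< (≤-trans 2+2k≤j j≤j⊖i)
      λ e → 0≢1+n (trans (sym (m*n%n≡0 (suc k) 2)) (trans (cong (_% 2) e) odd))

    k≤bound : k ≤ (j ⊖ i ∸ 3) / 2
    k≤bound = begin
      k               ≡⟨ m*n/n≡m k 2 ⟨
      k * 2 / 2       ≤⟨ /-monoˡ-≤ 2 (m+n≤o⇒m≤o∸n (k * 2) (subst (_≤ j ⊖ i) (+-comm 3 (k * 2)) 3+2k≤j⊖i)) ⟩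
      (j ⊖ i ∸ 3) / 2 ∎

    dense-≤ : ∀ k → 2 + k * 2 ≤ j → k ≤ (j ⊖ i ∸ 3) / 2 → k ≤ #≤ (j ∸ 2) (row² s)
    -- Condition (d) starts at 1; the value 0 occurs for `j` equal to 2 or 3.
    dense-≤ zero    _      _  = z≤n
    dense-≤ (suc k) 2+2k≤j k≤ = begin
      suc k
        ≤⟨ All.lookup dense (∈-[⋯]⁺ (s≤s z≤n) k≤) ⟩
      #⟨_,_⟩ sh (j ⊖ (1 + 2 * suc k)) (j ⊖ 2) (row² s)
        ≡⟨ #⟨⟩-ballot (suc k) (row² s)
             (subst (λ x → 2 + x ≤ j) (*-comm (suc k) 2) 2+2k≤j)
             (≤-trans (s≤s (s≤s (s≤s z≤n))) 2+2k≤j) j≤n ⟩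
      #[_,_] sh (j ∸ 1 ∸ 2 * suc k) (j ∸ 2) (row² s)
        ≤⟨ count-mono-≤ _ (_≤? j ∸ 2) proj₂ (row² s) ⟩
      #≤ (j ∸ 2) (row² s)
        ∎

    j-1∈² : j ∸ 1 ∈ row² s
    j-1∈² = subst (_∈ row² s) (⊖-linear 2≤j j≤n) j⊖1∈²

    j-2<j-1 : j ∸ 2 < j ∸ 1
    j-2<j-1 = ∸-monoʳ-< (s≤s (s≤s z≤n)) 2≤j

    j-1<j : j ∸ 1 < j
    j-1<j = ∸-monoʳ-< (s≤s z≤n) (<⇒≤ 2≤j)

    swap-≤ : ∀ {x} → x ≤ j ∸ 1 → swap i j x ≤ j
    swap-≤ {x} x≤j-1 = subst (_≤ j) (sym (swap-other (<⇒≢ (<-trans x<j j<i)) (<⇒≢ x<j))) (<⇒≤ x<j)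
      where
      x<j : x < j
      x<j = ≤-<-trans x≤j-1 j-1<j

    2+k≤# : 2 + k ≤ #≤ j (row² t)
    -- Three sources of entries: `k` entries up to `j ∸ 2` from condition (d), then `j ∸ 1`, and
    -- finally `i`, which lies above `j` in `s` but becomes `j` in `t`.
    2+k≤# = begin
      2 + k
        ≤⟨ s≤s (s≤s (dense-≤ k 2+2k≤j k≤bound)) ⟩
      2 + #≤ (j ∸ 2) (row² s)
        ≤⟨ s≤s (count-mono-< (_≤? j ∸ 2) (_≤? j ∸ 1) (λ x≤ → ≤-trans x≤ (<⇒≤ j-2<j-1))
                 j-1∈² (<⇒≱ j-2<j-1) ≤-refl) ⟩
      1 + #≤ (j ∸ 1) (row² s)
        ≤⟨ count-mono-< (_≤? j ∸ 1) (λ x → swap i j x ≤? j) swap-≤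
             i∈² (<⇒≱ (<-trans j-1<j j<i)) (≤-reflexive (swap-first i j)) ⟩
      length (filter (λ x → swap i j x ≤? j) (row² s))
        ≡⟨ #≤-interchange i j s t st j ⟨
      #≤ j (row² t)
        ∎

  -- Agreement of the cyclic and linear conditions for `1 < i < j ≤ n`.

  ∈row²⇒1< : ∀ (T : SYT sh) {x} → x ∈ row² (value T) → 1 < x
  ∈row²⇒1< (T , [ std ]) x∈² = ≤∧≢⇒< (proj₁ (entry-bounds T (inj₂ x∈²)))
    λ { refl → ⊥-elim-irr (1∉row² T std x∈²) }

  module _ {i j} (1<i : 1 < i) (i<j : i < j) (j≤n : j ≤ n) where
    private
      2<j : 2 < j
      2<j = ≤-trans (s≤s 1<i) i<j

      i⊕1≡i+1 : i ⊕ 1 ≡ i + 1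
      i⊕1≡i+1 = ⊕-linear i 1 ≤-refl (subst (_≤ n) (+-comm 1 i) (≤-trans i<j j≤n))

      i⊖1≡i-1 : i ⊖ 1 ≡ i ∸ 1
      i⊖1≡i-1 = ⊖-linear 1<i (≤-trans (<⇒≤ i<j) j≤n)

      j⊖1≡j-1 : j ⊖ 1 ≡ j ∸ 1
      j⊖1≡j-1 = ⊖-linear (<⇒≤ 2<j) j≤n

      j⊖i≡j-i : j ⊖ i ≡ j ∸ i
      j⊖i≡j-i = ⊖-linear i<j j≤n

      -- Of the neighbours `i ⊕ 1`, `i ⊖ 1`, `j ⊖ 1` and `j ⊕ 1`, only the last can wrap, namely for
      -- `j ≡ n`.
      j⊕1-cases : j ⊕ 1 ≡ 1 ⊎ j ⊕ 1 ≡ j + 1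
      j⊕1-cases with j ≟ n
      ... | yes j≡n = inj₁ (trans (cong (_⊕ 1) j≡n) n⊕1≡1)
      ... | no  j≢n = inj₂ (⊕-linear j 1 ≤-refl (subst (_≤ n) (+-comm 1 j) (≤∧≢⇒< j≤n j≢n)))

      i≢j⊕1 : i ≢ j ⊕ 1
      i≢j⊕1 e with j⊕1-cases
      ... | inj₁ f = <⇒≢ 1<i (sym (trans e f))
      ... | inj₂ f = <⇒≢ (<-≤-trans i<j (m≤m+n j 1)) (trans e f)

      ballot-interval : ∀ k xs → k ≤ (j ∸ i ∸ 3) / 2 →
        #⟨_,_⟩ sh (j ⊖ (1 + 2 * k)) (j ⊖ 2) xs ≡ #[_,_] sh (j ∸ 1 ∸ 2 * k) (j ∸ 2) xs
      -- From `2k ≤ j - i - 3` and `1 < i` follows `2k ≤ j - 2`, so the lower end is at least 1.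
      ballot-interval k xs k≤ = #⟨⟩-ballot k xs
        (subst (_≤ j) (+-comm (2 * k) 2) (m≤o∸n⇒m+n≤o (2 * k) (<⇒≤ 2<j) (begin
          2 * k               ≡⟨ *-comm 2 k ⟩
          k * 2               ≤⟨ *-monoˡ-≤ 2 k≤ ⟩
          (j ∸ i ∸ 3) / 2 * 2 ≤⟨ m/n*n≤m (j ∸ i ∸ 3) 2 ⟩
          j ∸ i ∸ 3           ≤⟨ m∸n≤m (j ∸ i) 3 ⟩
          j ∸ i               ≤⟨ ∸-monoʳ-≤ j 1<i ⟩
          j ∸ 2               ∎)))
        2<j j≤n
        where open ≤-Reasoning

      inner-interval : ∀ xs → j ≢ i + 1 → (j ∸ i) % 2 ≡ 1 →
        #⟨_,_⟩ sh (i ⊕ 2) (j ⊖ 2) xs ≡ #[_,_] sh (i + 2) (j ∸ 2) xs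
      inner-interval xs j≢i+1 odd = #⟨⟩-below xs
        (⊕-linear i 2 (s≤s z≤n) (≤-trans i+2≤j j≤n))
        (m+n≤o⇒m≤o∸n (i + 2) (subst (_≤ j) (+-comm 1 (i + 2)) (≤∧≢⇒< i+2≤j i+2≢j)))
        2<j j≤n
        where
        -- The hypothesis excludes `j ≡ i + 1` and the odd difference excludes `j ≡ i + 2`. Hence
        -- `i + 3 ≤ j`, which `#⟨⟩-below` asks for as `i + 2 ≤ j ∸ 1`.
        i+2≤j : i + 2 ≤ j
        i+2≤j = subst (_≤ j) (+-comm 2 i) (≤∧≢⇒< i<j (λ e → j≢i+1 (trans (sym e) (+-comm 1 i))))

        i+2≢j : i + 2 ≢ j
        i+2≢j refl = 0≢1+n (trans (cong (_% 2) (sym (m+n∸m≡n i 2))) odd)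

    cyclic₂⇒secondMove : ∀ s t → Cyclic₂ sh i j (value s) (value t) → SecondMove sh s t
    cyclic₂⇒secondMove s t (ist , _ , odd , (i⊕1∈¹ , j⊖1∈²) , adjacent , dense , full) =
      i , j , ist , (1<i , i<j , j≤n , odd′) ,
      (subst (_∈ row¹ (value s)) i⊕1≡i+1 i⊕1∈¹ , subst (_∈ row² (value s)) j⊖1≡j-1 j⊖1∈²) ,
      adjacent′ adjacent , dense′ , full′
      where
      odd′ : (j ∸ i) % 2 ≡ 1
      odd′ = trans (cong (_% 2) (sym j⊖i≡j-i)) odd

      adjacent′ : i ⊖ 1 ∈ row¹ (value s) ⊎ j ⊕ 1 ∈ row² (value s) →
                  i ∸ 1 ∈ row¹ (value s) ⊎ j + 1 ∈ row² (value s)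
      adjacent′ (inj₁ i⊖1∈¹) = inj₁ (subst (_∈ row¹ (value s)) i⊖1≡i-1 i⊖1∈¹)
      adjacent′ (inj₂ j⊕1∈²) with j⊕1-cases
      -- Here `j ≡ n` would place 1 in the second row of the standard tableau `s`, in agreement with
      -- the convention in (c).
      ... | inj₁ e = contradiction (sym e) (<⇒≢ (∈row²⇒1< s j⊕1∈²))
      ... | inj₂ e = inj₂ (subst (_∈ row² (value s)) e j⊕1∈²)

      dense′ : ∀ k → 1 ≤ k → k ≤ (j ∸ i ∸ 3) / 2 →
               k ≤ #[_,_] sh (j ∸ 1 ∸ 2 * k) (j ∸ 2) (row² (value s))
      dense′ k 1≤k k≤ = subst (k ≤_) (ballot-interval k (row² (value s)) k≤)
        (All.lookup dense (∈-[⋯]⁺ 1≤k (subst (λ d → k ≤ (d ∸ 3) / 2) (sym j⊖i≡j-i) k≤)))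

      full′ : j ≢ i + 1 → #[_,_] sh (i + 2) (j ∸ 2) (row² (value s)) ≡ (j ∸ i ∸ 3) / 2
      full′ j≢i+1 = trans (sym (inner-interval (row² (value s)) j≢i+1 odd′))
        (trans (full (λ e → j≢i+1 (trans e i⊕1≡i+1))) (cong (λ d → (d ∸ 3) / 2) j⊖i≡j-i))

    linear⇒cyclic₂ : ∀ (s t : RSYT sh) →
      i ∈ row² s × j ∈ row¹ s × Interchange sh i j s t →
      (j ∸ i) % 2 ≡ 1 →
      i + 1 ∈ row¹ s × j ∸ 1 ∈ row² s →
      i ∸ 1 ∈ row¹ s ⊎ j + 1 ∈ row² s →
      (∀ k → 1 ≤ k → k ≤ (j ∸ i ∸ 3) / 2 → k ≤ #[_,_] sh (j ∸ 1 ∸ 2 * k) (j ∸ 2) (row² s)) →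
      (j ≢ i + 1 → #[_,_] sh (i + 2) (j ∸ 2) (row² s) ≡ (j ∸ i ∸ 3) / 2) →
      Cyclic₂ sh i j s t
    linear⇒cyclic₂ s t ist odd (i+1∈¹ , j-1∈²) adjacent dense full =
      ist , i≢j⊕1 , trans (cong (_% 2) j⊖i≡j-i) odd ,
      (subst (_∈ row¹ s) (sym i⊕1≡i+1) i+1∈¹ , subst (_∈ row² s) (sym j⊖1≡j-1) j-1∈²) ,
      adjacent′ adjacent , All.tabulate dense′ , full′
      where
      adjacent′ : i ∸ 1 ∈ row¹ s ⊎ j + 1 ∈ row² s → i ⊖ 1 ∈ row¹ s ⊎ j ⊕ 1 ∈ row² s
      adjacent′ (inj₁ i-1∈¹) = inj₁ (subst (_∈ row¹ s) (sym i⊖1≡i-1) i-1∈¹)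
      -- That `j + 1` is an entry of `s` already gives `j + 1 ≤ n`.
      adjacent′ (inj₂ j+1∈²) = inj₂ (subst (_∈ row² s)
        (sym (⊕-linear j 1 ≤-refl (proj₂ (entry-bounds s (inj₂ j+1∈²))))) j+1∈²)

      dense′ : ∀ {k} → k ∈ [ 1 ⋯ (j ⊖ i ∸ 3) / 2 ] →
               k ≤ #⟨_,_⟩ sh (j ⊖ (1 + 2 * k)) (j ⊖ 2) (row² s)
      dense′ {k} k∈ with ∈-[⋯]⁻ k∈
      ... | 1≤k , k≤ = subst (k ≤_) (sym (ballot-interval k (row² s) k≤′)) (dense k 1≤k k≤′)
        where
        k≤′ : k ≤ (j ∸ i ∸ 3) / 2
        k≤′ = subst (λ d → k ≤ (d ∸ 3) / 2) j⊖i≡j-i k≤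

      full′ : j ≢ i ⊕ 1 → #⟨_,_⟩ sh (i ⊕ 2) (j ⊖ 2) (row² s) ≡ (j ⊖ i ∸ 3) / 2
      full′ j≢i⊕1 = trans (inner-interval (row² s) j≢i+1 odd)
        (trans (full j≢i+1) (cong (λ d → (d ∸ 3) / 2) (sym j⊖i≡j-i)))
        where
        j≢i+1 : j ≢ i + 1
        j≢i+1 e = j≢i⊕1 (trans e (sym i⊕1≡i+1))

  -- Cyclic moves between standard tableaux are the linear moves.

  firstMove⇒cyclicMove : ∀ s t → FirstMove sh s t → CyclicMove sh (value s) (value t)
  firstMove⇒cyclicMove s t (i , 1≤i , i≤n-1 , i∈¹ , i+1∈² , st) =
    inj₁ (lose (∈-[⋯]⁺ 1≤i (≤-trans i≤n-1 (m∸n≤m n 1)))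
      (i∈¹ , subst (λ x → x ∈ row² (value s) × Interchange sh i x (value s) (value t)) (sym i⊕1≡i+1) (i+1∈² , st)))
    where
    i⊕1≡i+1 : i ⊕ 1 ≡ i + 1
    i⊕1≡i+1 = ⊕-linear i 1 ≤-refl (proj₂ (entry-bounds (value s) (inj₂ i+1∈²)))

  secondMove⇒cyclicMove : ∀ s t → SecondMove sh s t → CyclicMove sh (value s) (value t)
  secondMove⇒cyclicMove s t (i , j , ist , (1<i , i<j , j≤n , odd) , ends , adjacent , dense , full) =
    inj₂ (lose (∈-[⋯]⁺ (<⇒≤ 1<i) (≤-trans (<⇒≤ i<j) j≤n))
      (lose (∈-[⋯]⁺ (<⇒≤ (<-trans 1<i i<j)) j≤n)
        (linear⇒cyclic₂ 1<i i<j j≤n (value s) (value t) ist odd ends adjacent dense full)))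

  -- Only wrapping moves have no linear counterpart. Standardness of `s` excludes the first kind
  -- with `i ≡ n`, which needs 1 in `row²`; standardness of `t` excludes the second kind with
  -- `j < i`.
  cyclicMove⇒move : ∀ s t → CyclicMove sh (value s) (value t) → FirstMove sh s t ⊎ SecondMove sh s t
  cyclicMove⇒move s t (inj₁ move) with find move
  ... | i , i∈ , i∈¹ , i⊕1∈² , st with i ≟ n
  ...   | yes i≡n = contradiction (sym (trans (cong (_⊕ 1) i≡n) n⊕1≡1)) (<⇒≢ (∈row²⇒1< s i⊕1∈²))
  ...   | no  i≢n = inj₁ (i , 1≤i , m+n≤o⇒m≤o∸n i i+1≤n , i∈¹ ,
          subst (λ x → x ∈ row² (value s) × Interchange sh i x (value s) (value t))
            (⊕-linear i 1 ≤-refl i+1≤n) (i⊕1∈² , st))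
    where
    1≤i : 1 ≤ i
    1≤i = proj₁ (∈-[⋯]⁻ i∈)

    i+1≤n : i + 1 ≤ n
    i+1≤n = subst (_≤ n) (+-comm 1 i) (≤∧≢⇒< (proj₂ (∈-[⋯]⁻ i∈)) i≢n)
  cyclicMove⇒move s t@(_ , [ std ]) (inj₂ moves) with find moves
  ... | i , _ , moves′ with find moves′
  ...   | j , j∈ , move@((i∈² , j∈¹ , _) , _) with <-cmp i j
  ...     | tri< i<j _ _ = inj₂ (cyclic₂⇒secondMove (∈row²⇒1< s i∈²) i<j (proj₂ (∈-[⋯]⁻ j∈)) s t move)
  ...     | tri≈ _ refl _ = ⊥-elim (rows-disjoint (value s) j∈¹ i∈²)
  ...     | tri> _ _ j<i = ⊥-elim-irr (cyclic₂-wrapping-nonstandard (value s) (value t) move j<i std)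

  -- Every move loses a descent, so the restriction to `[ 1 ⋯ n ∸ 1 ]` keeps its weight.

  descent-lost : ∀ (s t : SYT sh) {i} → i ∈ row¹ (value s) → i + 1 ∈ row² (value s) →
                 i ∈ row² (value t) ⊎ i + 1 ∈ row¹ (value t) →
                 ¬ LabeledGraph.τ (Γ sh) s ⊆ LabeledGraph.τ (Γ sh) t
  descent-lost s t {i} i∈¹ i+1∈² lost τs⊆τt = not-descent lost
    (proj₂ (∈-filter⁻ (higher? sh (value t)) {xs = [ 1 ⋯ n ]}
      (proj₁ (∈-filter⁻ (_∈? [ 1 ⋯ n ∸ 1 ]) {xs = desBar sh (value t)} (τs⊆τt i∈τs)))))
    where
    1≤i : 1 ≤ i
    1≤i = proj₁ (entry-bounds (value s) (inj₁ i∈¹))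

    i+1≤n : i + 1 ≤ n
    i+1≤n = proj₂ (entry-bounds (value s) (inj₂ i+1∈²))

    i⊕1≡i+1 : i ⊕ 1 ≡ i + 1
    i⊕1≡i+1 = ⊕-linear i 1 ≤-refl i+1≤n

    -- The descent survives the restriction of labels because `i + 1` is an entry, so `i ≤ n ∸ 1`.
    i∈τs : i ∈ LabeledGraph.τ (Γ sh) s
    i∈τs = ∈-filter⁺ (_∈? [ 1 ⋯ n ∸ 1 ])
      (∈-filter⁺ (higher? sh (value s)) (∈-[⋯]⁺ 1≤i (m+n≤o⇒m≤o i i+1≤n))
        (i∈¹ , subst (_∈ row² (value s)) (sym i⊕1≡i+1) i+1∈²))
      (∈-[⋯]⁺ 1≤i (m+n≤o⇒m≤o∸n i i+1≤n))

    not-descent : i ∈ row² (value t) ⊎ i + 1 ∈ row¹ (value t) →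
                  ¬ (i ∈ row¹ (value t) × i ⊕ 1 ∈ row² (value t))
    not-descent (inj₁ i∈²)   (i∈¹ , _)   = rows-disjoint (value t) i∈¹ i∈²
    not-descent (inj₂ i+1∈¹) (_ , i⊕1∈²) =
      rows-disjoint (value t) (subst (_∈ row¹ (value t)) (sym i⊕1≡i+1) i+1∈¹) i⊕1∈²

  firstMove-descent-lost : ∀ s t → FirstMove sh s t →
                           ¬ LabeledGraph.τ (Γ sh) s ⊆ LabeledGraph.τ (Γ sh) t
  firstMove-descent-lost s t (i , _ , _ , i∈¹ , i+1∈² , st) =
    descent-lost s t i∈¹ i+1∈² (inj₁ (interchange-first∈row² i (i + 1) (value s) (value t) st i+1∈²))

  -- Each alternative of condition (c) supplies a descent: `i ∸ 1` is lost because `i` moves up, or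
  -- `j` is lost because `j` moves down.
  secondMove-descent-lost : ∀ s t → SecondMove sh s t →
                            ¬ LabeledGraph.τ (Γ sh) s ⊆ LabeledGraph.τ (Γ sh) t
  -- Matching on `suc i` lets `i ∸ 1` reduce; the bound `1 < i` excludes zero.
  secondMove-descent-lost s t (suc i , j , (i∈² , j∈¹ , st) , _ , _ , inj₁ i-1∈¹ , _) =
    descent-lost s t i-1∈¹ (subst (_∈ row² (value s)) (+-comm 1 i) i∈²)
      (inj₂ (subst (_∈ row¹ (value t)) (+-comm 1 i) (interchange-first∈row¹ (suc i) j (value s) (value t) st j∈¹)))
  secondMove-descent-lost s t (i , j , (i∈² , j∈¹ , st) , _ , _ , inj₂ j+1∈² , _) =
    descent-lost s t j∈¹ j+1∈² (inj₁ (interchange-second∈row² i j (value s) (value t) st i∈²))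

  -- The weight function of `Γ` and its transport to left cells.

  Γ-m≡1 : ∀ s t → ¬ LabeledGraph.τ (Γ sh) s ⊆ LabeledGraph.τ (Γ sh) t →
          CyclicMove sh (value s) (value t) → LabeledGraph.m (Γ sh) s t ≡ 1L
  Γ-m≡1 s t τs⊈τt move = cong₂ (λ b c → if b then 0L else (if c then 1L else 0L))
    (dec-false (LabeledGraph.τ (Γ sh) s ⊆? LabeledGraph.τ (Γ sh) t) τs⊈τt)
    (dec-true (cyclicMove? sh (value s) (value t)) move)

  Γ-m≡0 : ∀ s t → ¬ CyclicMove sh (value s) (value t) → LabeledGraph.m (Γ sh) s t ≡ 0L
  Γ-m≡0 s t ¬move = trans
    (cong (λ c → if does τs⊆?τt then 0L else (if c then 1L else 0L))
      (dec-false (cyclicMove? sh (value s) (value t)) ¬move))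
    -- Both branches are now `0L`, whatever the descent sets are.
    (if-eta (does τs⊆?τt))
    where
    τs⊆?τt : Dec (LabeledGraph.τ (Γ sh) s ⊆ LabeledGraph.τ (Γ sh) t)
    τs⊆?τt = LabeledGraph.τ (Γ sh) s ⊆? LabeledGraph.τ (Γ sh) t

  Γ-givenByMoves : GivenByMoves sh (LabeledGraph.m (Γ sh))
  Γ-givenByMoves = record
    { first     = λ s t move k → cong (λ f → coeff f k)
        (Γ-m≡1 s t (firstMove-descent-lost s t move) (firstMove⇒cyclicMove s t move))
    ; second    = λ s t move k → cong (λ f → coeff f k)
        (Γ-m≡1 s t (secondMove-descent-lost s t move) (secondMove⇒cyclicMove s t move))
    ; otherwise = λ s t ¬first ¬second k → cong (λ f → coeff f k)
        (Γ-m≡0 s t (Sum.[ ¬first , ¬second ] ∘ cyclicMove⇒move s t))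
    }

  -- Graph isomorphisms preserve weights only up to `_≈_`, since a `Laurent` is a list of formal
  -- terms.
  givenByMoves-resp-≈ : ∀ {v w} → (∀ s t → v s t ≈ w s t) → GivenByMoves sh w → GivenByMoves sh v
  givenByMoves-resp-≈ v≈w g = record
    { first     = λ s t move k → trans (v≈w s t k) (first s t move k)
    ; second    = λ s t move k → trans (v≈w s t k) (second s t move k)
    ; otherwise = λ s t ¬first ¬second k → trans (v≈w s t k) (otherwise s t ¬first ¬second k)
    }
    where open GivenByMoves g

theorem7p8 : (n : ℕ) → 3 ≤ n → (sh : TwoRowPartition n) →
    GivenByMoves sh (LabeledGraph.m (Γ sh)) ×
    ((kl : KazhdanLusztigBasis n) (w₀ : Perm n) → HasShape kl w₀ sh →
    (φ : leftCellGraph kl w₀ ≅ Γ sh) →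
    GivenByMoves sh (λ s t → LabeledGraph.m (leftCellGraph kl w₀) (_≅_.from φ s) (_≅_.from φ t)))
theorem7p8 n _ sh = Γ-givenByMoves sh , λ kl w₀ _ φ →
  givenByMoves-resp-≈ sh
    -- `m-≈` compares with the weight at `to (from s)` and `to (from t)`, which `to-from` turns into
    -- `s` and `t`.
    (λ s t → subst₂ (λ u v → LabeledGraph.m (leftCellGraph kl w₀) (_≅_.from φ s) (_≅_.from φ t) ≈
                             LabeledGraph.m (Γ sh) u v)
      (_≅_.to-from φ s) (_≅_.to-from φ t)
      (_≅_.m-≈ φ (_≅_.from φ s) (_≅_.from φ t)))
    (Γ-givenByMoves sh)
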